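{- On the set of the $512$ mesh patterns $(21,R)$, $R\subseteq\{0,1,2\}\times\{0,1,2\}$, the equivalence relation of coincidence under $231$ (that is, $p_1\sim p_2$ if and only if $\mathrm{Av}(\{231,p_1\})=\mathrm{Av}(\{231,p_2\})$) has exactly $39$ equivalence classes.
   Context: Write $[n]=\{1,\dots,n\}$. A permutation of length $n$ is a bijection of $[n]$, written in one-line notation; $G(\pi)=\{(i,\pi(i)) : i\in[n]\}$ is its plot. A mesh pattern of length $k$ is a pair $p=(\tau,R)$ with $\tau$ a permutation of length $k$ and $R\subseteq\{0,\dots,k\}^2$. An occurrence of $p$ in a permutation $\pi$ of length $n$ is a subset $\omega\subseteq G(\pi)$ for which there are order-preserving injections $\alpha,\beta:[k]\to[n]$ such that (i) $\omega=\{(\alpha(i),\beta(j)):(i,j)\in G(\tau)\}$, and (ii) with $\alpha(0)=\beta(0)=0$, $\alpha(k+1)=\beta(k+1)=n+1$ and $R_{ij}=[\alpha(i)+1,\alpha(i+1)-1]\times[\beta(j)+1,\beta(j+1)-1]$, one has $R_{ij}\cap G(\pi)=\emptyset$ for every $(i,j)\in R$. A permutation avoids $p$ if it has no occurrence of $p$. A classical pattern $\pi$ is identified with the mesh pattern $(\pi,\emptyset)$. $\mathrm{Av}(S)$ is the set of all permutations (of all lengths, including the empty one) avoiding every pattern in $S$. -}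

module Defs where

open import Data.Fin.Base using (Fin; zero; suc; toℕ; inject₁; _≤_)
open import Data.Fin.Patterns using (0F; 1F; 2F)
open import Data.Fin.Permutation using (Permutation′; permutation; _⟨$⟩ʳ_)
open import Data.Fin.Subset using (Subset; ⊥) renaming (_∈_ to _∈ₛ_)
open import Data.Nat.Base as ℕ using (ℕ; zero; suc)
open import Data.Product.Base using (Σ; Σ-syntax; ∃-syntax; _×_; _,_)
open import Data.Vec.Base using (Vec; lookup; replicate)
open import Function.Bundles using (Bijection)
open import Function.Definitions using (Injective)
open import Level using (0ℓ; _⊔_) renaming (suc to lsuc)
open import Relation.Binary.Bundles using (Setoid)
open import Relation.Binary.Core using (Rel; _Preserves_⟶_)
open import Relation.Binary.PropositionalEquality.Core using (_≡_; refl)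
import Relation.Binary.PropositionalEquality.Properties as ≡
open import Relation.Nullary.Negation.Core using (¬_)
open import Relation.Unary using (Pred; _∈_; _∉_; _⊆_; _≐_; _∪_; ｛_｝)
open import Relation.Unary.Properties using (≐-refl; ≐-sym; ≐-trans)

-- The index i : Fin n stands for the element suc (toℕ i) of [n] = {1,…,n}.

Perm : Set
Perm = Σ ℕ Permutation′

G : ∀ {n} → Permutation′ n → Pred (Fin n × Fin n) 0ℓ
G π (i , j) = π ⟨$⟩ʳ i ≡ j

-- A subset R of {0,…,k}², stored by columns: (i , j) ∈ R iff j belongs to the
-- i-th entry.
Shading : ℕ → Set
Shading k = Vec (Subset (suc k)) (suc k)

_∈ᴿ_ : ∀ {k} → Fin (suc k) × Fin (suc k) → Shading k → Set
(i , j) ∈ᴿ R = j ∈ₛ lookup R i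

record MeshPattern : Set where
  constructor mesh
  field
    {size}  : ℕ
    τ       : Permutation′ size
    shading : Shading size

classical : ∀ {k} → Permutation′ k → MeshPattern
classical {k} τ = mesh τ (replicate (suc k) ⊥)

OrderPreservingInjection : ∀ {k n} → (Fin k → Fin n) → Set
OrderPreservingInjection α = α Preserves _≤_ ⟶ _≤_ × Injective _≡_ _≡_ α

-- tail α i is α(i+1) (with i counted from 0), as a number in {1,…,n+1}, with α(k+1) = n+1.
tail : ∀ {k n} → (Fin k → Fin n) → Fin (suc k) → ℕ
tail {zero}  {n} α zero    = suc n
tail {suc k}     α zero    = suc (toℕ (α zero))
tail {suc k}     α (suc i) = tail (λ j → α (suc j)) i

-- The extension of α : [k] → [n] to {0,…,k+1} by α(0) = 0 and α(k+1) = n+1.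
extend : ∀ {k n} → (Fin k → Fin n) → Fin (suc (suc k)) → ℕ
extend α zero    = 0
extend α (suc i) = tail α i

-- The integer interval [α(i)+1, α(i+1)-1].
Gap : ∀ {k n} → (Fin k → Fin n) → Fin (suc k) → Pred (Fin n) 0ℓ
Gap α i x = extend α (inject₁ i) ℕ.< suc (toℕ x) × suc (toℕ x) ℕ.< extend α (suc i)

Box : ∀ {k n} (α β : Fin k → Fin n) → Fin (suc k) × Fin (suc k) →
      Pred (Fin n × Fin n) 0ℓ
Box α β (i , j) (x , y) = x ∈ Gap α i × y ∈ Gap β j

Image : ∀ {k n} (α β : Fin k → Fin n) → Permutation′ k → Pred (Fin n × Fin n) 0ℓ
Image α β τ xy = ∃[ i ] ∃[ j ] (i , j) ∈ G τ × xy ≡ (α i , β j)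

IsOccurrence : MeshPattern → ∀ {n} → Permutation′ n → Pred (Fin n × Fin n) 0ℓ → Set
IsOccurrence (mesh {k} τ R) {n} π ω =
  ω ⊆ G π ×
  Σ[ α ∈ (Fin k → Fin n) ] Σ[ β ∈ (Fin k → Fin n) ]
    OrderPreservingInjection α ×
    OrderPreservingInjection β ×
    ω ≐ Image α β τ ×
    (∀ ij → ij ∈ᴿ R → ∀ xy → xy ∈ Box α β ij → xy ∉ G π)

Avoids : Perm → MeshPattern → Set₁
Avoids (n , π) p = ∀ (ω : Pred (Fin n × Fin n) 0ℓ) → ¬ IsOccurrence p π ω

Av : Pred MeshPattern 0ℓ → Pred Perm (lsuc 0ℓ)
Av S π = ∀ p → p ∈ S → Avoids π p

CoincideUnder : MeshPattern → Rel MeshPattern (lsuc 0ℓ)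
CoincideUnder q p₁ p₂ = Av (｛ q ｝ ∪ ｛ p₁ ｝) ≐ Av (｛ q ｝ ∪ ｛ p₂ ｝)

perm21 : Permutation′ 2
perm21 = permutation f f inv inv
  where
  f : Fin 2 → Fin 2
  f 0F = 1F
  f 1F = 0F
  inv : ∀ i → f (f i) ≡ i
  inv 0F = refl
  inv 1F = refl

perm231 : Permutation′ 3
perm231 = permutation f g fg gf
  where
  f g : Fin 3 → Fin 3
  f 0F = 1F
  f 1F = 2F
  f 2F = 0F
  g 0F = 2F
  g 1F = 0F
  g 2F = 1F
  fg : ∀ i → f (g i) ≡ i
  fg 0F = refl
  fg 1F = refl
  fg 2F = refl
  gf : ∀ i → g (f i) ≡ i
  gf 0F = refl
  gf 1F = refl
  gf 2F = refl

-- The patterns (τ , R), parametrised by R, up to coincidence under q.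
coincidenceSetoid : MeshPattern → ∀ {k} → Permutation′ k → Setoid 0ℓ (lsuc 0ℓ)
coincidenceSetoid q {k} τ = record
  { Carrier       = Shading k
  ; _≈_           = λ R₁ R₂ → CoincideUnder q (mesh τ R₁) (mesh τ R₂)
  ; isEquivalence = record { refl = ≐-refl ; sym = ≐-sym ; trans = ≐-trans }
  }

-- A map to Fin m that respects and reflects _≈_ and is onto is a bijection from
-- the set of equivalence classes to Fin m.
HasClasses : ∀ {a ℓ} → Setoid a ℓ → ℕ → Set (a ⊔ ℓ)
HasClasses S m = Bijection S (≡.setoid (Fin m))

{-# OPTIONS --safe #-}
-- In a 231-avoiding permutation two of the nine cells of an inversion, (0 , 1)
-- and (1 , 2), are always empty, so shading them changes nothing.  Other cells
-- can be added to a shading by an extremal argument: if a point lies in such a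
-- cell, replacing one end of the inversion by that point gives an inversion
-- that still respects the shading, and a rank of the inversion decreases.
-- Reading five such arguments backwards, as permissions to remove cells, every
-- shading reduces to the least shading of its class.  There are 39 least
-- shadings, and eight permutations of length at most 5 tell them apart.
module Submission where

open import Defs

open import Data.Bool.Base using (Bool; true; false; if_then_else_)
import Data.Bool.Properties as Bool
open import Data.Empty using (⊥-elim)
open import Data.Fin.Base using (Fin; zero; suc; toℕ; punchIn; _<_; _≤_)
open import Data.Fin.Patterns
open import Data.Fin.Permutation using (Permutation′; permutation; _⟨$⟩ʳ_)
open import Data.Fin.Properties as Fin
  using (_≟_; _<?_; any?; all?; <-cmp; <-trans; <-irrefl; <-asym; ≤∧≢⇒<; toℕ≤n)
open import Data.Fin.Subset using (inside; outside; _∪_; _─_) renaming (_∈_ to _∈ₛ_; _⊆_ to _⊆ₛ_)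
open import Data.Fin.Subset.Properties
  using (_∈?_; _⊆?_; ∉⊥; p─q⊆p; x∈p∪q⁻; x∈p∧x∉q⇒x∈p─q)
open import Data.List.Base using (List; []; _∷_)
open import Data.Nat.Base as ℕ using (ℕ; zero; suc; _∸_; z≤n; s<s; s<s⁻¹; z<s)
open import Data.Nat.Induction using (<-wellFounded)
import Data.Nat.Properties as ℕ
open import Data.Product.Base using (∃-syntax; ∃₂; _×_; _,_; proj₁; proj₂; uncurry)
open import Data.Sum.Base using (_⊎_; inj₁; inj₂)
open import Data.Vec.Base using (Vec; []; _∷_; lookup; zipWith; here; there)
import Data.Vec.Functional as V
open import Data.Vec.Properties using (≡-dec; lookup-replicate; lookup-zipWith)
open import Function.Base using (_∘_; id)
open import Function.Bundles using (Injection; mk⇔)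
open import Function.Properties.Inverse using (↔⇒↣)
open import Induction.WellFounded using (Acc; acc)
open import Level using (0ℓ)
open import Relation.Binary.Core using (Rel)
open import Relation.Binary.Definitions using (tri<; tri≈; tri>)
open import Relation.Binary.PropositionalEquality
  using (_≡_; _≢_; refl; sym; trans; cong; cong₂; subst; subst₂)
open import Relation.Nullary using (Dec; yes; no; ¬_; does)
open import Relation.Nullary.Decidable
  using (_×-dec_; _→-dec_; _⊎-dec_; ¬?; map′; True; toWitness; does-⇔; decidable-stable)
open import Relation.Unary as Unary using (Pred; Decidable; ｛_｝)

private variable
  m n : ℕ

Pt : ℕ → Set
Pt n = Fin n × Fin n

Cell : Set
Cell = Fin 3 × Fin 3

-- Zones and cells

-- The intervals of `Gap` for two marks, without the sentinel bounds, which every index satisfies.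
Zone : Fin 3 → (l u x : Fin n) → Set
Zone 0F l u x = x < l
Zone 1F l u x = l < x × x < u
Zone 2F l u x = u < x

zone? : ∀ z (l u x : Fin n) → Dec (Zone z l u x)
zone? 0F l u x = x <? l
zone? 1F l u x = l <? x ×-dec x <? u
zone? 2F l u x = u <? x

zone-≢ : ∀ z {l u x : Fin n} → l < u → Zone z l u x → x ≢ l × x ≢ u
zone-≢ 0F l<u x<l         = (λ eq → <-irrefl eq x<l) , λ eq → <-irrefl eq (<-trans x<l l<u)
zone-≢ 1F l<u (l<x , x<u) = (λ eq → <-irrefl (sym eq) l<x) , λ eq → <-irrefl eq x<u
zone-≢ 2F l<u u<x         =
  (λ eq → <-irrefl (sym eq) (<-trans l<u u<x)) , λ eq → <-irrefl (sym eq) u<x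

zone-unique : ∀ z z′ {l u x : Fin n} → l < u → Zone z l u x → Zone z′ l u x → z ≡ z′
zone-unique 0F 0F l<u p q = refl
zone-unique 0F 1F l<u p q = ⊥-elim (<-asym p (proj₁ q))
zone-unique 0F 2F l<u p q = ⊥-elim (<-asym (<-trans p l<u) q)
zone-unique 1F 0F l<u p q = ⊥-elim (<-asym q (proj₁ p))
zone-unique 1F 1F l<u p q = refl
zone-unique 1F 2F l<u p q = ⊥-elim (<-asym q (proj₂ p))
zone-unique 2F 0F l<u p q = ⊥-elim (<-asym (<-trans q l<u) p)
zone-unique 2F 1F l<u p q = ⊥-elim (<-asym p (proj₂ q))
zone-unique 2F 2F l<u p q = refl

-- p is to the left of and above q.
Descent : Rel (Pt n) 0ℓ
Descent (i , y) (j , z) = i < j × z < y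

descent? : ∀ (p q : Pt n) → Dec (Descent p q)
descent? (i , y) (j , z) = i <? j ×-dec z <? y

-- Rows are cut at z and then at y, because the right end of a descent is the lower one.
InCell : (p q : Pt n) → Cell → Pred (Pt n) 0ℓ
InCell (i , y) (j , z) (c , r) (k , w) = Zone c i j k × Zone r z y w

inCell? : ∀ (p q : Pt n) e x → Dec (InCell p q e x)
inCell? (i , y) (j , z) (c , r) (k , w) = zone? c i j k ×-dec zone? r z y w

_∈ᴿ?_ : ∀ e (R : Shading 2) → Dec (e ∈ᴿ R)
(c , r) ∈ᴿ? R = r ∈? lookup R c

_⊆ᴿ_ : Rel (Shading 2) 0ℓ
R ⊆ᴿ S = ∀ c → lookup R c ⊆ₛ lookup S c

_⊆ᴿ?_ : ∀ R S → Dec (R ⊆ᴿ S)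
R ⊆ᴿ? S = all? λ c → lookup R c ⊆? lookup S c

_∪ᴿ_ _─ᴿ_ : Shading 2 → Shading 2 → Shading 2
_∪ᴿ_ = zipWith _∪_
_─ᴿ_ = zipWith _─_

∈-∪ᴿ⁻ : ∀ R S {e} → e ∈ᴿ (R ∪ᴿ S) → e ∈ᴿ R ⊎ e ∈ᴿ S
∈-∪ᴿ⁻ R S {c , r} e∈ =
  x∈p∪q⁻ (lookup R c) (lookup S c) (subst (λ T → r ∈ₛ T) (lookup-zipWith _∪_ c R S) e∈)

─ᴿ-⊆ : ∀ R S → (R ─ᴿ S) ⊆ᴿ R
─ᴿ-⊆ R S c r∈ =
  p─q⊆p (lookup R c) (lookup S c) (subst (λ T → _ ∈ₛ T) (lookup-zipWith _─_ c R S) r∈)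

-- Strictly monotone maps and slots

Strict : (Fin m → Fin n) → Set
Strict α = ∀ {a b} → a < b → α a < α b

strict⇒≤ : {α : Fin m → Fin n} → Strict α → ∀ {a b} → a ≤ b → α a ≤ α b
strict⇒≤ {α = α} α↑ {a} {b} a≤b with a ≟ b
... | yes refl = ℕ.≤-refl
... | no a≢b   = ℕ.<⇒≤ (α↑ (≤∧≢⇒< a≤b a≢b))

strict-reflects : {α : Fin m → Fin n} → Strict α → ∀ {a b} → α a < α b → a < b
strict-reflects α↑ {a} {b} αa<αb with <-cmp a b
... | tri< a<b _ _    = a<b
... | tri≈ _ refl _   = ⊥-elim (<-irrefl refl αa<αb)
... | tri> _ _ b<a    = ⊥-elim (<-asym αa<αb (α↑ b<a))

strict⇒opi : {α : Fin m → Fin n} → Strict α → OrderPreservingInjection α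
strict⇒opi {α = α} α↑ = strict⇒≤ α↑ , injective
  where
  injective : ∀ {a b} → α a ≡ α b → a ≡ b
  injective {a} {b} eq with <-cmp a b
  ... | tri< a<b _ _ = ⊥-elim (<-irrefl eq (α↑ a<b))
  ... | tri≈ _ a≡b _ = a≡b
  ... | tri> _ _ b<a = ⊥-elim (<-irrefl (sym eq) (α↑ b<a))

opi⇒strict : {α : Fin m → Fin n} → OrderPreservingInjection α → Strict α
opi⇒strict (mono , inj) a<b = ≤∧≢⇒< (mono (ℕ.<⇒≤ a<b)) (λ eq → <-irrefl (inj eq) a<b)

pair-strict : {x y : Fin n} → x < y → Strict (x V.∷ y V.∷ V.[])
pair-strict x<y {0F} {1F} _ = x<y
pair-strict x<y {1F} {1F} (s<s ())

triple-strict : {x y z : Fin n} → x < y → y < z → Strict (x V.∷ y V.∷ z V.∷ V.[])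
triple-strict x<y y<z {0F} {1F} _ = x<y
triple-strict x<y y<z {0F} {2F} _ = <-trans x<y y<z
triple-strict x<y y<z {1F} {1F} (s<s ())
triple-strict x<y y<z {1F} {2F} _ = y<z
triple-strict x<y y<z {2F} {1F} (s<s ())
triple-strict x<y y<z {2F} {2F} (s<s (s<s ()))

-- The zone of x is also its place in sorted order: x sits at index z, and `punchIn z` gives the
-- indices of l and u.
insert : Fin 3 → (l u x : Fin n) → Fin 3 → Fin n
insert 0F l u x = x V.∷ l V.∷ u V.∷ V.[]
insert 1F l u x = l V.∷ x V.∷ u V.∷ V.[]
insert 2F l u x = l V.∷ u V.∷ x V.∷ V.[]

insert-strict : ∀ z {l u x : Fin n} → l < u → Zone z l u x → Strict (insert z l u x)
insert-strict 0F l<u x<l         = triple-strict x<l l<u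
insert-strict 1F l<u (l<x , x<u) = triple-strict l<x x<u
insert-strict 2F l<u u<x         = triple-strict l<u u<x

insert-new : ∀ z {l u x : Fin n} → insert z l u x z ≡ x
insert-new 0F = refl
insert-new 1F = refl
insert-new 2F = refl

insert-lower : ∀ z {l u x : Fin n} → insert z l u x (punchIn z 0F) ≡ l
insert-lower 0F = refl
insert-lower 1F = refl
insert-lower 2F = refl

insert-upper : ∀ z {l u x : Fin n} → insert z l u x (punchIn z 1F) ≡ u
insert-upper 0F = refl
insert-upper 1F = refl
insert-upper 2F = refl

-- Non-strict on the right, so that every x lies in a slot, a value of α included.
Slot : (Fin m → Fin n) → Fin (suc m) → Pred (Fin n) 0ℓ
Slot α s x = ∀ a → (toℕ a ℕ.< toℕ s → α a < x) × (toℕ s ℕ.≤ toℕ a → x ≤ α a)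

slot : {α : Fin m → Fin n} → Strict α → ∀ x → ∃[ s ] Slot α s x
slot {m = zero}          α↑ x = 0F , λ ()
slot {m = suc m} {α = α} α↑ x with x Fin.≤? α 0F
... | yes x≤α0 = 0F , λ a → (λ ()) , λ _ → ℕ.≤-trans x≤α0 (strict⇒≤ α↑ z≤n)
... | no  x≰α0 with slot {α = α ∘ suc} (λ a<b → α↑ (s<s a<b)) x
...   | s , sl = suc s , λ where
  zero    → (λ _ → ℕ.≰⇒> x≰α0) , λ ()
  (suc a) → (λ a<s → proj₁ (sl a) (s<s⁻¹ a<s)) , λ s≤a → proj₂ (sl a) (ℕ.s≤s⁻¹ s≤a)

-- The decisions are arguments, so that a case split on them makes the zone compute.
zoneFrom : ∀ {P Q : Set} → Dec P → Dec Q → Fin 3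
zoneFrom s≤u? s≤v? = if does s≤u? then 0F else if does s≤v? then 1F else 2F

-- The slot s of x counts the values of α below x, so comparing s with an index compares x with the
-- value there. The zone thus depends on grid indices alone.
slotZone : (u v : Fin 3) → Fin 4 → Fin 3
slotZone u v s = zoneFrom (s Fin.≤? u) (s Fin.≤? v)

-- The upper bounds of a slot are weak; they become strict because x differs from both marks.
slot⇒zone : {α : Fin 3 → Fin n} → ∀ {s x} u v → Slot α s x → x ≢ α u → x ≢ α v →
            Zone (slotZone u v s) (α u) (α v) x
slot⇒zone {α = α} {s} {x} u v sl x≢αu x≢αv = go (s Fin.≤? u) (s Fin.≤? v)
  where
  go : (p : Dec (s ≤ u)) (q : Dec (s ≤ v)) → Zone (zoneFrom p q) (α u) (α v) x
  go (yes s≤u) _         = ≤∧≢⇒< (proj₂ (sl u) s≤u) x≢αu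
  go (no s≰u)  (yes s≤v) = proj₁ (sl u) (ℕ.≰⇒> s≰u) , ≤∧≢⇒< (proj₂ (sl v) s≤v) x≢αv
  go (no s≰u)  (no s≰v)  = proj₁ (sl v) (ℕ.≰⇒> s≰v)

zone-reflect : {α : Fin m → Fin n} → Strict α → ∀ z {l u x} →
               Zone z (α l) (α u) (α x) → Zone z l u x
zone-reflect α↑ 0F p       = strict-reflects α↑ p
zone-reflect α↑ 1F (p , q) = strict-reflects α↑ p , strict-reflects α↑ q
zone-reflect α↑ 2F p       = strict-reflects α↑ p

-- Replacing an endpoint of an inversion

-- An inversion and a third point in its cell e span a 3 × 3 grid, in which e is
-- also the position of the third point.
upperLeft lowerRight : Cell → Pt 3
upperLeft  (c , r) = punchIn c 0F , punchIn r 1F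
lowerRight (c , r) = punchIn c 1F , punchIn r 0F

slotCell : (P Q : Pt 3) → Fin 4 × Fin 4 → Cell
slotCell (u , hi) (v , lo) (s , t) = slotZone u v s , slotZone lo hi t

-- A point in one of these cells would complete a 231 with the inversion.
void : Shading 2
void = (outside ∷ inside  ∷ outside ∷ [])
     ∷ (outside ∷ outside ∷ inside  ∷ [])
     ∷ (outside ∷ outside ∷ outside ∷ [])
     ∷ []

data Side : Set where
  keepLeft keepRight : Side

newLeft newRight dropped : Side → Cell → Pt 3
newLeft  keepLeft  e = upperLeft e
newLeft  keepRight e = e
newRight keepLeft  e = e
newRight keepRight e = lowerRight e
dropped  keepLeft  e = lowerRight e
dropped  keepRight e = upperLeft e

Void : (P Q : Pt 3) → Fin 4 × Fin 4 → Set
Void P Q st = Descent P Q × slotCell P Q st ∈ᴿ void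

-- Four reasons why no further point lies in a slot: it is in a shaded or void cell of the old
-- inversion, or in a void cell of an inversion that the third point forms with one of the old ends.
Absorbed : Shading 2 → Cell → Fin 4 × Fin 4 → Set
Absorbed R e st =
  (slotCell (upperLeft e) (lowerRight e) st ∈ᴿ R ⊎ Void (upperLeft e) (lowerRight e) st) ⊎
  (Void (upperLeft e) e st ⊎ Void e (lowerRight e) st)

-- The third point replaces an end of the inversion.  The middle condition keeps
-- the end that was given up out of the shaded cells of the new inversion; the
-- last one says that every other point in such a cell was already excluded.
Safe : Side → Shading 2 → Cell → Set
Safe σ R e =
  Descent (newLeft σ e) (newRight σ e) ×
  (∀ c r → (c , r) ∈ᴿ R → ¬ InCell (newLeft σ e) (newRight σ e) (c , r) (dropped σ e)) ×
  (∀ s t → slotCell (newLeft σ e) (newRight σ e) (s , t) ∈ᴿ R → Absorbed R e (s , t))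

void? : ∀ P Q st → Dec (Void P Q st)
void? P Q st = descent? P Q ×-dec slotCell P Q st ∈ᴿ? void

safe? : ∀ σ R e → Dec (Safe σ R e)
safe? σ R e =
  descent? L Q
  ×-dec (all? λ c → all? λ r → (c , r) ∈ᴿ? R →-dec ¬? (inCell? L Q (c , r) (dropped σ e)))
  ×-dec (all? λ s → all? λ t → slotCell L Q (s , t) ∈ᴿ? R →-dec
    ((slotCell A B (s , t) ∈ᴿ? R ⊎-dec void? A B (s , t)) ⊎-dec
     (void? A e (s , t) ⊎-dec void? e B (s , t))))
  where
  A = upperLeft e
  B = lowerRight e
  L = newLeft σ e
  Q = newRight σ e

-- Permutations avoiding 231

infixl 9 _!_
_!_ : Permutation′ n → Fin n → Pt n
π ! i = i , π ⟨$⟩ʳ i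

Inversion : Permutation′ n → Rel (Fin n) 0ℓ
Inversion π i j = Descent (π ! i) (π ! j)

Clear : Permutation′ n → Shading 2 → Rel (Fin n) 0ℓ
Clear π R i j = ∀ c r → (c , r) ∈ᴿ R → ∀ x → ¬ InCell (π ! i) (π ! j) (c , r) (π ! x)

Contains21 : Permutation′ n → Pred (Shading 2) 0ℓ
Contains21 π R = ∃₂ λ i j → Inversion π i j × Clear π R i j

Contains231 : Permutation′ n → Set
Contains231 π = ∃[ i ] ∃[ j ] ∃[ k ] (i < j × j < k) ×
  ((π ⟨$⟩ʳ k) < (π ⟨$⟩ʳ i) × (π ⟨$⟩ʳ i) < (π ⟨$⟩ʳ j))

contains21? : (π : Permutation′ n) → Decidable (Contains21 π)
contains21? π R = any? λ i → any? λ j → descent? (π ! i) (π ! j) ×-dec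
  (all? λ c → all? λ r → (c , r) ∈ᴿ? R →-dec
    (all? λ x → ¬? (inCell? (π ! i) (π ! j) (c , r) (π ! x))))

contains231? : (π : Permutation′ n) → Dec (Contains231 π)
contains231? π = any? λ i → any? λ j → any? λ k →
  (i <? j ×-dec j <? k) ×-dec
  ((π ⟨$⟩ʳ k) <? (π ⟨$⟩ʳ i) ×-dec (π ⟨$⟩ʳ i) <? (π ⟨$⟩ʳ j))

contains21-antitone : (π : Permutation′ n) → ∀ R S → R ⊆ᴿ S → Contains21 π S → Contains21 π R
contains21-antitone π R S R⊆S (i , j , inv , clear) = i , j , inv , λ c r e∈R → clear c r (R⊆S c e∈R)

perm-injective : (π : Permutation′ n) → ∀ {i j} → π ⟨$⟩ʳ i ≡ π ⟨$⟩ʳ j → i ≡ j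
perm-injective π = Injection.injective (↔⇒↣ π)

-- In cell (0 , 1) the point is the 2 of a 231 whose 3 and 1 are the ends of the inversion; in (1 ,
-- 2) it is the 3, between the ends as 2 and 1.
void-empty : (π : Permutation′ n) → ¬ Contains231 π → ∀ {i j} → Inversion π i j →
             ∀ e → e ∈ᴿ void → ∀ x → ¬ InCell (π ! i) (π ! j) e (π ! x)
void-empty π av {i} {j} (i<j , πj<πi) (0F , 1F) _ x (x<i , πj<πx , πx<πi) =
  av (x , i , j , (x<i , i<j) , πj<πx , πx<πi)
void-empty π av {i} {j} (i<j , πj<πi) (1F , 2F) _ x ((i<x , x<j) , πi<πx) =
  av (i , x , j , (i<x , x<j) , πj<πi , πi<πx)
void-empty π av inv (0F , 2F) (there (there ())) x
void-empty π av inv (1F , 1F) (there ()) x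
void-empty π av inv (2F , 1F) (there ()) x
void-empty π av inv (2F , 2F) (there (there ())) x

-- Transfer from the grid to a permutation

module _ {α β : Fin 3 → Fin n} (α↑ : Strict α) (β↑ : Strict β) where

  embed : Pt 3 → Pt n
  embed (a , b) = α a , β b

  embed-descent : ∀ {P Q} → Descent P Q → Descent (embed P) (embed Q)
  embed-descent (p , q) = α↑ p , β↑ q

  embed-inCell : ∀ {P Q D} e → InCell (embed P) (embed Q) e (embed D) → InCell P Q e D
  embed-inCell (c , r) (p , q) = zone-reflect α↑ c p , zone-reflect β↑ r q

  module _ (π : Permutation′ n) where

    -- A record, so that P can be inferred; the bare equation would unfold to values of α and β.
    record At (P : Pt 3) (i : Fin n) : Set where
      constructor at
      field onGrid : embed P ≡ π ! i

    at-≢ : ∀ {P i y} → At P i → y ≢ i → y ≢ α (proj₁ P) × π ⟨$⟩ʳ y ≢ β (proj₂ P)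
    at-≢ (at eq) y≢i =
      (λ y≡ → y≢i (trans y≡ (cong proj₁ eq))) ,
      (λ πy≡ → y≢i (perm-injective π (trans πy≡ (cong proj₂ eq))))

    at-inversion : ∀ {P Q p q} → At P p → At Q q → Descent P Q → Inversion π p q
    at-inversion (at eqP) (at eqQ) = subst₂ Descent eqP eqQ ∘ embed-descent

    slot⇒inCell : ∀ {P Q p q s t y} → At P p → At Q q → y ≢ p → y ≢ q →
                  Slot α s y → Slot β t (π ⟨$⟩ʳ y) →
                  InCell (π ! p) (π ! q) (slotCell P Q (s , t)) (π ! y)
    slot⇒inCell {s = s} {t} {y} P@(at eqP) Q@(at eqQ) y≢p y≢q sl tl =
      subst₂ (λ a b → InCell a b (slotCell _ _ (s , t)) (π ! y)) eqP eqQ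
        ( slot⇒zone _ _ sl (proj₁ (at-≢ P y≢p)) (proj₁ (at-≢ Q y≢q))
        , slot⇒zone _ _ tl (proj₂ (at-≢ Q y≢q)) (proj₂ (at-≢ P y≢p)) )

    inCell-≢ : ∀ {p q y} e → Inversion π p q → InCell (π ! p) (π ! q) e (π ! y) → y ≢ p × y ≢ q
    inCell-≢ (c , r) (p<q , _) (z , _) = zone-≢ c p<q z

    module _ {R : Shading 2} {i j x : Fin n} {e : Cell}
             (A : At (upperLeft e) i) (B : At (lowerRight e) j) (E : At e x)
             (av : ¬ Contains231 π) (inv : Inversion π i j) (clear : Clear π R i j) where

      absorbed-empty : ∀ {s t y} → y ≢ i → y ≢ j → y ≢ x →
                       Slot α s y → Slot β t (π ⟨$⟩ʳ y) → ¬ Absorbed R e (s , t)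
      absorbed-empty y≢i y≢j y≢x sl tl (inj₁ (inj₁ old)) =
        clear _ _ old _ (slot⇒inCell A B y≢i y≢j sl tl)
      absorbed-empty y≢i y≢j y≢x sl tl (inj₁ (inj₂ (d , v))) =
        void-empty π av inv _ v _ (slot⇒inCell A B y≢i y≢j sl tl)
      absorbed-empty y≢i y≢j y≢x sl tl (inj₂ (inj₁ (d , v))) =
        void-empty π av (at-inversion A E d) _ v _ (slot⇒inCell A E y≢i y≢x sl tl)
      absorbed-empty y≢i y≢j y≢x sl tl (inj₂ (inj₂ (d , v))) =
        void-empty π av (at-inversion E B d) _ v _ (slot⇒inCell E B y≢x y≢j sl tl)

      -- A point of a shaded new cell is either the dropped end, which `noD` excludes on the grid,
      -- or a fourth point, whose slot is excluded by `absorb`.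
      clear-new : ∀ {P Q D p q d} → At P p → At Q q → At D d → Descent P Q →
        (∀ c r → (c , r) ∈ᴿ R → ¬ InCell P Q (c , r) D) →
        (∀ s t → slotCell P Q (s , t) ∈ᴿ R → Absorbed R e (s , t)) →
        (∀ {y} → y ≢ p → y ≢ q → y ≢ d → y ≢ i × y ≢ j × y ≢ x) →
        Clear π R p q
      clear-new {P} {Q} {D} {p} {q} {d} atP@(at eqP) atQ@(at eqQ) (at eqD) desc noD absorb others c r e∈R y y∈
        with d ≟ y
      ... | yes refl = noD c r e∈R (embed-inCell (c , r)
              (subst₂ (λ a b → InCell a b (c , r) _) (sym eqP) (sym eqQ)
                (subst (InCell _ _ (c , r)) (sym eqD) y∈)))
      ... | no d≢y with slot α↑ y | slot β↑ (π ⟨$⟩ʳ y)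
      ...   | s , sl | t , tl = absorbed-empty y≢i y≢j y≢x sl tl (absorb s t (subst (_∈ᴿ R) cell≡ e∈R))
        where
        inv′ : Inversion π p q
        inv′ = at-inversion atP atQ desc
        y≢ : y ≢ p × y ≢ q
        y≢ = inCell-≢ (c , r) inv′ y∈
        y∈′ : InCell (π ! p) (π ! q) (slotCell P Q (s , t)) (π ! y)
        y∈′ = slot⇒inCell atP atQ (proj₁ y≢) (proj₂ y≢) sl tl
        -- Both cells contain y and belong to one inversion, whose cells are disjoint.
        cell≡ : (c , r) ≡ slotCell P Q (s , t)
        cell≡ = cong₂ _,_ (zone-unique c _ (proj₁ inv′) (proj₁ y∈) (proj₁ y∈′))
                          (zone-unique r _ (proj₂ inv′) (proj₂ y∈) (proj₂ y∈′))
        y≢ijx : y ≢ i × y ≢ j × y ≢ x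
        y≢ijx = others (proj₁ y≢) (proj₂ y≢) (d≢y ∘ sym)
        y≢i = proj₁ y≢ijx
        y≢j = proj₁ (proj₂ y≢ijx)
        y≢x = proj₂ (proj₂ y≢ijx)

replace : Side → (i j x : Fin n) → Fin n × Fin n
replace keepLeft  i j x = i , x
replace keepRight i j x = x , j

-- The finite check `Safe` carries over to every 231-avoiding permutation, since increasing maps
-- place the grid on the three points.
replace-clear : (π : Permutation′ n) → ¬ Contains231 π → ∀ σ R {e} → Safe σ R e →
  ∀ {i j x} → Inversion π i j → Clear π R i j → InCell (π ! i) (π ! j) e (π ! x) →
  let p , q = replace σ i j x in Inversion π p q × Clear π R p q
replace-clear π av σ R {c , r} safe {i} {j} {x} inv@(i<j , πj<πi) clear (zc , zr) = go σ safe
  where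
  -- The grid lines are the positions and the values of i, j and x, each in increasing order.
  α↑ = insert-strict c i<j zc
  β↑ = insert-strict r πj<πi zr
  A : At α↑ β↑ π (upperLeft (c , r)) i
  A = at (cong₂ _,_ (insert-lower c) (insert-upper r))
  B : At α↑ β↑ π (lowerRight (c , r)) j
  B = at (cong₂ _,_ (insert-upper c) (insert-lower r))
  E : At α↑ β↑ π (c , r) x
  E = at (cong₂ _,_ (insert-new c) (insert-new r))
  go : ∀ σ → Safe σ R (c , r) → let p , q = replace σ i j x in Inversion π p q × Clear π R p q
  go keepLeft (desc , noD , absorb) =
    at-inversion α↑ β↑ π A E desc ,
    clear-new α↑ β↑ π {R = R} A B E av inv clear A E B desc noD absorb (λ p q d → p , d , q)
  go keepRight (desc , noD , absorb) =
    at-inversion α↑ β↑ π E B desc ,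
    clear-new α↑ β↑ π {R = R} A B E av inv clear E B A desc noD absorb (λ p q d → d , q , p)

-- Extending a shading

record Rule : Set where
  field
    cells    : Shading 2
    side     : Side
    rank     : Permutation′ n → Fin n → Fin n → ℕ
    descends : (π : Permutation′ n) → ∀ {i j x} e → e ∈ᴿ cells →
               InCell (π ! i) (π ! j) e (π ! x) →
               let p , q = replace side i j x in rank π p q ℕ.< rank π i j

open Rule

Admissible : Rule → Pred (Shading 2) 0ℓ
Admissible ρ R = ∀ c r → (c , r) ∈ᴿ cells ρ → Safe (side ρ) R (c , r)

admissible? : ∀ ρ → Decidable (Admissible ρ)
admissible? ρ R = all? λ c → all? λ r → (c , r) ∈ᴿ? cells ρ →-dec safe? (side ρ) R (c , r)

-- A point in an added cell permits a replacement that keeps R clear and lowers the rank. This stops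
-- at an inversion whose added cells are empty too.
extend-clear : (π : Permutation′ n) → ¬ Contains231 π → ∀ ρ R → Admissible ρ R →
  ∀ i j → Acc ℕ._<_ (rank ρ π i j) → Inversion π i j → Clear π R i j → Contains21 π (R ∪ᴿ cells ρ)
extend-clear π av ρ R adm i j (acc rec) inv clear
  with any? (λ x → any? (λ c → any? (λ r →
         (c , r) ∈ᴿ? cells ρ ×-dec inCell? (π ! i) (π ! j) (c , r) (π ! x))))
... | no none = i , j , inv , clear′
  where
  clear′ : Clear π (R ∪ᴿ cells ρ) i j
  clear′ c r e∈ x x∈ with ∈-∪ᴿ⁻ R (cells ρ) e∈
  ... | inj₁ e∈R = clear c r e∈R x x∈
  ... | inj₂ e∈X = none (x , c , r , e∈X , x∈)
... | yes (x , c , r , e∈X , x∈)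
  with replace-clear π av (side ρ) R (adm c r e∈X) inv clear x∈
... | inv′ , clear′ = extend-clear π av ρ R adm _ _ (rec (descends ρ π (c , r) e∈X x∈)) inv′ clear′

enlarge : Rule → Shading 2 → Shading 2
enlarge ρ R = if does (admissible? ρ R) then R ∪ᴿ cells ρ else R

enlarge-contains : (π : Permutation′ n) → ¬ Contains231 π → ∀ ρ R →
  Contains21 π R → Contains21 π (enlarge ρ R)
enlarge-contains π av ρ R con@(i , j , inv , clear) = go (admissible? ρ R)
  where
  go : (d : Dec (Admissible ρ R)) → Contains21 π (if does d then R ∪ᴿ cells ρ else R)
  go (yes adm) = extend-clear π av ρ R adm i j (<-wellFounded _) inv clear
  go (no _)    = con

enlargeAll : List Rule → Shading 2 → Shading 2
enlargeAll []       R = R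
enlargeAll (ρ ∷ ρs) R = enlargeAll ρs (enlarge ρ R)

enlargeAll-contains : (π : Permutation′ n) → ¬ Contains231 π → ∀ ρs R →
  Contains21 π R → Contains21 π (enlargeAll ρs R)
enlargeAll-contains π av []       R con = con
enlargeAll-contains π av (ρ ∷ ρs) R con =
  enlargeAll-contains π av ρs (enlarge ρ R) (enlarge-contains π av ρ R con)

uncovered : List Rule → Shading 2 → Shading 2
uncovered []       R = R
uncovered (ρ ∷ ρs) R = uncovered ρs (R ─ᴿ cells ρ)

uncovered-⊆ : ∀ ρs R → uncovered ρs R ⊆ᴿ R
uncovered-⊆ []       R c = id
uncovered-⊆ (ρ ∷ ρs) R c = ─ᴿ-⊆ R (cells ρ) c ∘ uncovered-⊆ ρs (R ─ᴿ cells ρ) c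

-- When the side conditions of the rules fail, enlargeAll adds too little, the
-- inclusion fails, and R is left alone.
shrink : List Rule → Shading 2 → Shading 2
shrink ρs R = if does (R ⊆ᴿ? enlargeAll ρs S) then S else R
  where S = uncovered ρs R

-- Equivalence of shadings over 231-avoiding permutations

infix 4 _≈_
record _≈_ (R S : Shading 2) : Set where
  field
    to   : (π : Permutation′ n) → ¬ Contains231 π → Contains21 π R → Contains21 π S
    from : (π : Permutation′ n) → ¬ Contains231 π → Contains21 π S → Contains21 π R

open _≈_

≈-refl : ∀ {R} → R ≈ R
≈-refl = record { to = λ π av → id ; from = λ π av → id }

≈-sym : ∀ {R S} → R ≈ S → S ≈ R
≈-sym R≈S = record { to = from R≈S ; from = to R≈S }

≈-trans : ∀ {R S T} → R ≈ S → S ≈ T → R ≈ T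
≈-trans R≈S S≈T = record
  { to   = λ π av → to S≈T π av ∘ to R≈S π av
  ; from = λ π av → from R≈S π av ∘ from S≈T π av
  }

-- With S below R and R below the enlargement of S, containment passes from R to S by dropping
-- cells, and from S to R because the rules regain them.
shrink-≈ : ∀ ρs R → shrink ρs R ≈ R
shrink-≈ ρs R = go (R ⊆ᴿ? enlargeAll ρs S)
  where
  S = uncovered ρs R
  go : (d : Dec (R ⊆ᴿ enlargeAll ρs S)) → (if does d then S else R) ≈ R
  go (yes R⊆) = record
    { to   = λ π av → contains21-antitone π R (enlargeAll ρs S) R⊆ ∘ enlargeAll-contains π av ρs S
    ; from = λ π av → contains21-antitone π S R (uncovered-⊆ ρs R)
    }
  go (no _) = ≈-refl

void-≈ : ∀ R → (R ─ᴿ void) ≈ R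
void-≈ R = record
  { to   = λ π av (i , j , inv , clear) → i , j , inv , clear′ π av inv clear
  ; from = λ π av → contains21-antitone π (R ─ᴿ void) R (─ᴿ-⊆ R void)
  }
  where
  clear′ : (π : Permutation′ n) → ¬ Contains231 π → ∀ {i j} →
           Inversion π i j → Clear π (R ─ᴿ void) i j → Clear π R i j
  clear′ π av inv clear c r e∈R x x∈ with (c , r) ∈ᴿ? void
  ... | yes e∈v = void-empty π av inv (c , r) e∈v x x∈
  ... | no  e∉v = clear c r
          (subst (r ∈ₛ_) (sym (lookup-zipWith _ c R void)) (x∈p∧x∉q⇒x∈p─q e∈R e∉v)) x x∈

-- Normal forms

pattern ○ = outside
pattern ● = inside

-- Listed by columns, each column from bottom to top.
shading : (a b c d e f g h i : Bool) → Shading 2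
shading a b c d e f g h i =
  (a ∷ b ∷ c ∷ []) ∷ (d ∷ e ∷ f ∷ []) ∷ (g ∷ h ∷ i ∷ []) ∷ []

-- The extremal choices behind the ranks: leftmost upper end, leftmost lower end,
-- rightmost upper end, lowest lower end, rightmost lower end.
emptyTopLeft emptyMiddleˡ emptyMiddleʳ emptyBottom emptyRight : Rule
emptyTopLeft = record
  { cells    = shading ○ ○ ●  ○ ○ ○  ○ ○ ○
  ; side     = keepRight
  ; rank     = λ π i j → toℕ i
  ; descends = λ where
      π (0F , 2F) _ (x<i , _) → x<i
      π (0F , 1F) (there ())
      π (1F , 1F) (there ())
      π (1F , 2F) (there (there ()))
      π (2F , 1F) (there ())
      π (2F , 2F) (there (there ()))
  }
emptyMiddleˡ = record
  { cells    = shading ○ ○ ○  ○ ● ○  ○ ○ ○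
  ; side     = keepLeft
  ; rank     = λ π i j → toℕ j
  ; descends = λ where
      π (1F , 1F) _ ((_ , x<j) , _) → x<j
      π (0F , 1F) (there ())
      π (0F , 2F) (there (there ()))
      π (1F , 2F) (there (there ()))
      π (2F , 1F) (there ())
      π (2F , 2F) (there (there ()))
  }
emptyMiddleʳ = record
  { cells    = shading ○ ○ ○  ○ ● ○  ○ ○ ○
  ; side     = keepRight
  ; rank     = λ {n} π i j → n ∸ toℕ i
  ; descends = λ where
      π {x = x} (1F , 1F) _ ((i<x , _) , _) → ℕ.∸-monoʳ-< i<x (toℕ≤n x)
      π (0F , 1F) (there ())
      π (0F , 2F) (there (there ()))
      π (1F , 2F) (there (there ()))
      π (2F , 1F) (there ())
      π (2F , 2F) (there (there ()))
  }
emptyBottom = record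
  { cells    = shading ○ ○ ○  ● ○ ○  ● ○ ○
  ; side     = keepLeft
  ; rank     = λ π i j → toℕ (π ⟨$⟩ʳ j)
  ; descends = λ where
      π (1F , 0F) _ (_ , πx<πj) → πx<πj
      π (2F , 0F) _ (_ , πx<πj) → πx<πj
      π (0F , 1F) (there ())
      π (0F , 2F) (there (there ()))
      π (1F , 1F) (there ())
      π (1F , 2F) (there (there ()))
      π (2F , 1F) (there ())
      π (2F , 2F) (there (there ()))
  }
emptyRight = record
  { cells    = shading ○ ○ ○  ○ ○ ○  ● ● ○
  ; side     = keepLeft
  ; rank     = λ {n} π i j → n ∸ toℕ j
  ; descends = λ where
      π {x = x} (2F , 0F) _ (j<x , _) → ℕ.∸-monoʳ-< j<x (toℕ≤n x)
      π {x = x} (2F , 1F) _ (j<x , _) → ℕ.∸-monoʳ-< j<x (toℕ≤n x)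
      π (0F , 1F) (there ())
      π (0F , 2F) (there (there ()))
      π (1F , 1F) (there ())
      π (1F , 2F) (there (there ()))
      π (2F , 2F) (there (there ()))
  }

-- The order matters: a shaded middle cell blocks the other three rules.  The two
-- compound entries are for shadings whose middle cell can only be added after
-- the cells of emptyBottom or emptyRight.
strategies : List (List Rule)
strategies = (emptyMiddleˡ ∷ [])
           ∷ (emptyMiddleʳ ∷ [])
           ∷ (emptyBottom ∷ emptyMiddleʳ ∷ [])
           ∷ (emptyRight ∷ emptyMiddleʳ ∷ [])
           ∷ (emptyTopLeft ∷ [])
           ∷ []

shrinkAll : List (List Rule) → Shading 2 → Shading 2
shrinkAll []         R = R
shrinkAll (ρs ∷ ρss) R = shrinkAll ρss (shrink ρs R)

shrinkAll-≈ : ∀ ρss R → shrinkAll ρss R ≈ R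
shrinkAll-≈ []         R = ≈-refl
shrinkAll-≈ (ρs ∷ ρss) R = ≈-trans (shrinkAll-≈ ρss (shrink ρs R)) (shrink-≈ ρs R)

-- The void cells go first, so shadings that differ only there share a normal form.
normalize : Shading 2 → Shading 2
normalize R = shrinkAll strategies (R ─ᴿ void)

normalize-≈ : ∀ R → normalize R ≈ R
normalize-≈ R = ≈-trans (shrinkAll-≈ strategies (R ─ᴿ void)) (void-≈ R)

-- In increasing order as binary numerals, the last cell most significant. No entry meets `void`.
normalForms : Vec (Shading 2) 39
normalForms =
    shading ○ ○ ○  ○ ○ ○  ○ ○ ○
  ∷ shading ● ○ ○  ○ ○ ○  ○ ○ ○
  ∷ shading ○ ○ ●  ○ ● ○  ● ○ ○
  ∷ shading ● ○ ●  ○ ● ○  ● ○ ○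
  ∷ shading ○ ○ ●  ● ● ○  ● ○ ○
  ∷ shading ● ○ ●  ● ● ○  ● ○ ○
  ∷ shading ○ ○ ○  ● ○ ○  ○ ● ○
  ∷ shading ● ○ ○  ● ○ ○  ○ ● ○
  ∷ shading ○ ○ ●  ● ○ ○  ○ ● ○
  ∷ shading ● ○ ●  ● ○ ○  ○ ● ○
  ∷ shading ○ ○ ○  ● ○ ○  ● ● ○
  ∷ shading ● ○ ○  ● ○ ○  ● ● ○
  ∷ shading ○ ○ ●  ● ○ ○  ● ● ○
  ∷ shading ● ○ ●  ● ○ ○  ● ● ○
  ∷ shading ● ○ ○  ○ ● ○  ● ● ○
  ∷ shading ○ ○ ●  ○ ● ○  ● ● ○
  ∷ shading ● ○ ●  ○ ● ○  ● ● ○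
  ∷ shading ○ ○ ●  ● ● ○  ● ● ○
  ∷ shading ● ○ ●  ● ● ○  ● ● ○
  ∷ shading ○ ○ ○  ○ ○ ○  ○ ○ ●
  ∷ shading ● ○ ○  ○ ○ ○  ○ ○ ●
  ∷ shading ● ○ ○  ○ ● ○  ● ○ ●
  ∷ shading ○ ○ ●  ○ ● ○  ● ○ ●
  ∷ shading ● ○ ●  ○ ● ○  ● ○ ●
  ∷ shading ○ ○ ○  ● ● ○  ● ○ ●
  ∷ shading ● ○ ○  ● ● ○  ● ○ ●
  ∷ shading ○ ○ ●  ● ● ○  ● ○ ●
  ∷ shading ● ○ ●  ● ● ○  ● ○ ●
  ∷ shading ○ ○ ○  ● ○ ○  ○ ● ●
  ∷ shading ● ○ ○  ● ○ ○  ○ ● ●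
  ∷ shading ○ ○ ●  ● ○ ○  ○ ● ●
  ∷ shading ○ ○ ○  ● ○ ○  ● ● ●
  ∷ shading ● ○ ○  ● ○ ○  ● ● ●
  ∷ shading ○ ○ ●  ● ○ ○  ● ● ●
  ∷ shading ● ○ ○  ○ ● ○  ● ● ●
  ∷ shading ○ ○ ●  ○ ● ○  ● ● ●
  ∷ shading ● ○ ●  ○ ● ○  ● ● ●
  ∷ shading ○ ○ ●  ● ● ○  ● ● ●
  ∷ shading ● ○ ●  ● ● ○  ● ● ●
  ∷ []

_≟ᴿ_ : (R S : Shading 2) → Dec (R ≡ S)
_≟ᴿ_ = ≡-dec (≡-dec Bool._≟_)

isNormalForm? : ∀ R → Dec (∃[ k ] R ≡ lookup normalForms k)
isNormalForm? R = any? λ k → R ≟ᴿ lookup normalForms k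

Classified : Pred (Shading 2) 0ℓ
Classified R = ∃[ k ] normalize R ≡ lookup normalForms k

classified? : Decidable Classified
classified? R = isNormalForm? (normalize R)

-- Exhaustive check of the classification

Exhaustible : Set → Set₁
Exhaustible A = (P : Pred A 0ℓ) → Decidable P → Dec (∀ a → P a)

allBool? : Exhaustible Bool
allBool? P P? = map′ (λ { (pf , pt) false → pf ; (pf , pt) true → pt }) (λ p → p false , p true)
                     (P? false ×-dec P? true)

allVec? : ∀ {A} → Exhaustible A → ∀ n → Exhaustible (Vec A n)
allVec? allA? zero    P P? = map′ (λ { p [] → p }) (λ p → p []) (P? [])
allVec? allA? (suc n) P P? = map′ (λ { p (a ∷ as) → p a as }) (λ p a as → p (a ∷ as))
  (allA? (λ a → ∀ as → P (a ∷ as)) λ a → allVec? allA? n (λ as → P (a ∷ as)) λ as → P? (a ∷ as))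

abstract
  classify : ∀ R → Classified R
  -- A shading is a 3 by 3 array of Booleans, so the nested search evaluates all 512 cases.
  classify = toWitness {a? = allVec? (allVec? allBool? 3) 3 Classified classified?} _

-- Distinguishing permutations

IsInverse : (f g : Vec (Fin n) n) → Set
IsInverse f g = ∀ i → lookup f (lookup g i) ≡ i

isInverse? : (f g : Vec (Fin n) n) → Dec (IsInverse f g)
isInverse? f g = all? λ i → lookup f (lookup g i) ≟ i

word : (f g : Vec (Fin n) n) {_ : True (isInverse? f g)} {_ : True (isInverse? g f)} → Perm
word f g {fg} {gf} = _ , permutation (lookup f) (lookup g) (toWitness fg) (toWitness gf)

-- One-line notation from 0, followed by the inverse.
tests : Vec Perm 8
tests =
    word (0F ∷ 2F ∷ 1F ∷ []) (0F ∷ 2F ∷ 1F ∷ [])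
  ∷ word (1F ∷ 0F ∷ 2F ∷ []) (1F ∷ 0F ∷ 2F ∷ [])
  ∷ word (2F ∷ 0F ∷ 1F ∷ []) (1F ∷ 2F ∷ 0F ∷ [])
  ∷ word (2F ∷ 1F ∷ 0F ∷ []) (2F ∷ 1F ∷ 0F ∷ [])
  ∷ word (3F ∷ 0F ∷ 2F ∷ 1F ∷ []) (1F ∷ 3F ∷ 2F ∷ 0F ∷ [])
  ∷ word (3F ∷ 1F ∷ 0F ∷ 2F ∷ []) (2F ∷ 1F ∷ 3F ∷ 0F ∷ [])
  ∷ word (3F ∷ 2F ∷ 0F ∷ 1F ∷ []) (2F ∷ 3F ∷ 1F ∷ 0F ∷ [])
  ∷ word (4F ∷ 1F ∷ 0F ∷ 3F ∷ 2F ∷ []) (2F ∷ 1F ∷ 4F ∷ 3F ∷ 0F ∷ [])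
  ∷ []

TestAvoids231 : Pred (Fin 8) 0ℓ
TestAvoids231 t = ¬ Contains231 (proj₂ (lookup tests t))

Passes : Fin 39 → Pred (Fin 8) 0ℓ
Passes k t = Contains21 (proj₂ (lookup tests t)) (lookup normalForms k)

passes? : ∀ k → Decidable (Passes k)
passes? k t = contains21? (proj₂ (lookup tests t)) (lookup normalForms k)

SameResult : (k l : Fin 39) → Pred (Fin 8) 0ℓ
SameResult k l t = does (passes? k t) ≡ does (passes? l t)

Separated : Rel (Fin 39) 0ℓ
Separated k l = (∀ t → SameResult k l t) → k ≡ l

separated? : ∀ k → Decidable (Separated k)
separated? k l = all? {P = SameResult k l} (λ t → does (passes? k t) Bool.≟ does (passes? l t)) →-dec k ≟ l

abstract
  testAvoids231 : ∀ t → TestAvoids231 t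
  testAvoids231 = toWitness
    {a? = all? {P = TestAvoids231} λ t → ¬? (contains231? (proj₂ (lookup tests t)))} _

  separated : ∀ k l → Separated k l
  separated = toWitness {a? = all? {P = λ k → ∀ l → Separated k l} λ k → all? (separated? k)} _

-- Equivalent shadings agree on every 231-avoiding test, and by `separated` no two normal forms have
-- the same eight results.
normalForms-injective : ∀ k l → lookup normalForms k ≈ lookup normalForms l → k ≡ l
normalForms-injective k l k≈l = separated k l λ t →
  let π = proj₂ (lookup tests t) in
  does-⇔ (mk⇔ (to k≈l π (testAvoids231 t)) (from k≈l π (testAvoids231 t))) (passes? k t) (passes? l t)

-- Occurrences

gap⇒zone : (α : Fin 2 → Fin n) → ∀ c {x} → Gap α c x → Zone c (α 0F) (α 1F) x
gap⇒zone α 0F (_ , x<) = s<s⁻¹ x<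
gap⇒zone α 1F (<x , x<) = s<s⁻¹ <x , s<s⁻¹ x<
gap⇒zone α 2F (<x , _) = s<s⁻¹ <x

zone⇒gap : (α : Fin 2 → Fin n) → ∀ c {x} → Zone c (α 0F) (α 1F) x → Gap α c x
zone⇒gap α 0F x<         = z<s , s<s x<
zone⇒gap α 1F (<x , x<)  = s<s <x , s<s x<
-- The bound `toℕ<n` puts x below the sentinel n + 1.
zone⇒gap α 2F {x} <x     = s<s <x , s<s (Fin.toℕ<n x)

image⊆G : ∀ {k} (τ : Permutation′ k) (π : Permutation′ n) {α β : Fin k → Fin n} →
          (∀ i → π ⟨$⟩ʳ α i ≡ β (τ ⟨$⟩ʳ i)) → Image α β τ Unary.⊆ G π
image⊆G τ π graph (i , _ , refl , refl) = graph i

occurrence⇒contains21 : ∀ (π : Permutation′ n) R {ω} → IsOccurrence (mesh perm21 R) π ω → Contains21 π R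
occurrence⇒contains21 π R (ω⊆G , α , β , α↑ , β↑ , (_ , image⊆ω) , empty) =
  α 0F , α 1F , (opi⇒strict α↑ z<s , subst₂ _<_ (sym π1) (sym π0) (opi⇒strict β↑ z<s)) ,
  λ c r e∈R x (zc , zr) →
    empty (c , r) e∈R (x , π ⟨$⟩ʳ x)
      (zone⇒gap α c zc , zone⇒gap β r (subst₂ (λ l u → Zone r l u _) π1 π0 zr)) refl
  where
  -- The points (0 , 1) and (1 , 0) of the pattern land in ω, hence on the plot of π.
  π0 : π ⟨$⟩ʳ α 0F ≡ β 1F
  π0 = ω⊆G (image⊆ω (0F , 1F , refl , refl))
  π1 : π ⟨$⟩ʳ α 1F ≡ β 0F
  π1 = ω⊆G (image⊆ω (1F , 0F , refl , refl))

contains21⇒occurrence : ∀ (π : Permutation′ n) R → Contains21 π R → ∃[ ω ] IsOccurrence (mesh perm21 R) π ω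
contains21⇒occurrence π R (i , j , (i<j , πj<πi) , clear) =
  Image α β perm21 , image⊆G perm21 π graph , α , β ,
  strict⇒opi (pair-strict i<j) , strict⇒opi (pair-strict πj<πi) , (id , id) ,
  λ { (c , r) e∈R (x , _) (gc , gr) refl → clear c r e∈R x (gap⇒zone α c gc , gap⇒zone β r gr) }
  where
  α = i V.∷ j V.∷ V.[]
  -- β must increase, so the value of the right end comes first.
  β = (π ⟨$⟩ʳ j) V.∷ (π ⟨$⟩ʳ i) V.∷ V.[]
  graph : ∀ a → π ⟨$⟩ʳ α a ≡ β (perm21 ⟨$⟩ʳ a)
  graph 0F = refl
  graph 1F = refl

occurrence⇒contains231 : ∀ (π : Permutation′ n) {ω} → IsOccurrence (classical perm231) π ω → Contains231 π
occurrence⇒contains231 π (ω⊆G , α , β , α↑ , β↑ , (_ , image⊆ω) , _) =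
  α 0F , α 1F , α 2F , (opi⇒strict α↑ z<s , opi⇒strict α↑ (s<s z<s)) ,
  subst₂ _<_ (sym (π≡ 2F)) (sym (π≡ 0F)) (opi⇒strict β↑ z<s) ,
  subst₂ _<_ (sym (π≡ 0F)) (sym (π≡ 1F)) (opi⇒strict β↑ (s<s z<s))
  where
  π≡ : ∀ a → π ⟨$⟩ʳ α a ≡ β (perm231 ⟨$⟩ʳ a)
  π≡ a = ω⊆G (image⊆ω (a , _ , refl , refl))

contains231⇒occurrence : ∀ (π : Permutation′ n) → Contains231 π → ∃[ ω ] IsOccurrence (classical perm231) π ω
contains231⇒occurrence π (i , j , k , (i<j , j<k) , πk<πi , πi<πj) =
  Image α β perm231 , image⊆G perm231 π graph , α , β ,
  strict⇒opi (triple-strict i<j j<k) , strict⇒opi (triple-strict πk<πi πi<πj) , (id , id) ,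
  -- A classical pattern shades no cell, so this condition is vacuous.
  λ { (c , r) e∈ → ⊥-elim (∉⊥ (subst (r ∈ₛ_) (lookup-replicate c _) e∈)) }
  where
  α = i V.∷ j V.∷ k V.∷ V.[]
  β = (π ⟨$⟩ʳ k) V.∷ (π ⟨$⟩ʳ i) V.∷ (π ⟨$⟩ʳ j) V.∷ V.[]
  graph : ∀ a → π ⟨$⟩ʳ α a ≡ β (perm231 ⟨$⟩ʳ a)
  graph 0F = refl
  graph 1F = refl
  graph 2F = refl

-- Coincidence and equivalence of shadings

Coincide : Rel (Shading 2) _
Coincide R S = CoincideUnder (classical perm231) (mesh perm21 R) (mesh perm21 S)

≈⇒av : ∀ {R S} → R ≈ S →
  Av (｛ classical perm231 ｝ Unary.∪ ｛ mesh perm21 R ｝) Unary.⊆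
  Av (｛ classical perm231 ｝ Unary.∪ ｛ mesh perm21 S ｝)
≈⇒av R≈S         av _ (inj₁ refl) = av _ (inj₁ refl)
≈⇒av {R} {S} R≈S {_ , π} av _ (inj₂ refl) ω occ =
  uncurry (av _ (inj₂ refl)) (contains21⇒occurrence π R (from R≈S π no231 (occurrence⇒contains21 π S occ)))
  where
  no231 : ¬ Contains231 π
  no231 = uncurry (av _ (inj₁ refl)) ∘ contains231⇒occurrence π

≈⇒coincide : ∀ {R S} → R ≈ S → Coincide R S
≈⇒coincide R≈S = (λ {π} → ≈⇒av R≈S {π}) , λ {π} → ≈⇒av (≈-sym R≈S) {π}

-- Inclusion of avoidance classes only refutes the absence of R; as `Contains21` is decidable for a
-- given π, this yields an actual inversion.
av⇒contains : ∀ {R S} →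
  Av (｛ classical perm231 ｝ Unary.∪ ｛ mesh perm21 R ｝) Unary.⊆
  Av (｛ classical perm231 ｝ Unary.∪ ｛ mesh perm21 S ｝) →
  (π : Permutation′ n) → ¬ Contains231 π → Contains21 π S → Contains21 π R
av⇒contains {R = R} {S} R⊆S π no231 con = decidable-stable (contains21? π R) λ ¬R →
  uncurry (R⊆S {_ , π} (avoids ¬R) _ (inj₂ refl)) (contains21⇒occurrence π S con)
  where
  avoids : ¬ Contains21 π R → Av (｛ classical perm231 ｝ Unary.∪ ｛ mesh perm21 R ｝) (_ , π)
  avoids ¬R _ (inj₁ refl) ω = no231 ∘ occurrence⇒contains231 π
  avoids ¬R _ (inj₂ refl) ω = ¬R ∘ occurrence⇒contains21 π R

coincide⇒≈ : ∀ {R S} → Coincide R S → R ≈ S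
coincide⇒≈ (R⊆S , S⊆R) = record
  { to   = av⇒contains λ {π} → S⊆R {π}
  ; from = av⇒contains λ {π} → R⊆S {π}
  }

class : Shading 2 → Fin 39
class R = proj₁ (classify R)

class-≈ : ∀ R → lookup normalForms (class R) ≈ R
class-≈ R = subst (_≈ R) (proj₂ (classify R)) (normalize-≈ R)

class-cong : ∀ {R S} → R ≈ S → class R ≡ class S
class-cong {R} {S} R≈S = normalForms-injective (class R) (class S)
  (≈-trans (class-≈ R) (≈-trans R≈S (≈-sym (class-≈ S))))

class-injective : ∀ {R S} → class R ≡ class S → R ≈ S
class-injective {R} {S} eq =
  ≈-trans (≈-sym (class-≈ R)) (subst (λ k → lookup normalForms k ≈ S) (sym eq) (class-≈ S))

mainTheorem5 : HasClasses (coincidenceSetoid (classical perm231) perm21) 39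
mainTheorem5 = record
  { to        = class
  ; cong      = class-cong ∘ coincide⇒≈
  -- Surjectivity: the normal form of any R that coincides with the k-th normal form is equivalent
  -- to that form, so its index is k.
  ; bijective = ≈⇒coincide ∘ class-injective , λ k → lookup normalForms k , λ {R} R~k →
      normalForms-injective (class R) k (≈-trans (class-≈ R) (coincide⇒≈ R~k))
  }
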